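{- There is a positive absolute constant $k$ such that for every integer $c\ge 3$, $$G_c^{2/\varphi(c)}>k\,c.$$
   Context: For a positive integer $n$, $R(n)$ denotes the product of the distinct primes dividing $n$. $\varphi$ is Euler's totient function. For $c\ge3$, $G_c$ is the product of $R(abc)$ over all pairs of positive integers $(a,b)$ with $a+b=c$, $a<b$, $\gcd(a,b)=1$ (there are $\varphi(c)/2$ such pairs), so $G_c^{2/\varphi(c)}$ is the geometric mean of these radicals. -}

module Defs where

open import Data.Nat.Base using (ℕ; suc; _+_; _*_; _∸_; _^_; _<_; s≤s; z≤n)
open import Data.Nat.Properties
  using (_≟_; _<?_; m≤m+n; m+n∸m≡n)
open import Data.Nat.Coprimality using (Coprime; coprime?; 1-coprimeTo)
open import Data.Nat.Divisibility using (_∣?_)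
open import Data.Nat.ListAction using (product)
open import Data.Nat.Primality using (prime?)
open import Data.Integer.Base using (+_)
open import Data.Rational.Base as ℚ using (ℚ; 0ℚ)
open import Algebra.Definitions.RawSemiring ℚ.+-*-rawSemiring
  using () renaming (_^_ to _^ℚ_)
open import Data.List.Base using (List; map; filter; length; upTo; applyUpTo)
open import Data.List.Membership.Propositional using (_∈_)
open import Data.List.Membership.Propositional.Properties
  using (∈-filter⁺; ∈-filter⁻; ∈-map⁺; ∈-applyUpTo⁺; ∈-upTo⁺)
open import Data.List.Relation.Unary.Unique.Propositional using (Unique)
open import Data.List.Relation.Unary.Unique.Propositional.Properties
  using (filter⁺; map⁺; upTo⁺)
open import Data.List.Relation.Unary.Any using (here; there)
open import Data.Product.Base using (_×_; _,_; proj₁; proj₂)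
open import Data.Sum.Base using (_⊎_)
open import Function.Bundles using (_⇔_; mk⇔)
open import Level using (0ℓ)
open import Relation.Binary.PropositionalEquality using (_≡_; refl; cong; subst)
open import Relation.Nullary.Decidable using (_×-dec_)
open import Relation.Unary using (Pred; Decidable)

R : ℕ → ℕ
R n = product (filter (λ p → prime? p ×-dec p ∣? n) (upTo (suc n)))

φ : ℕ → ℕ
φ n = length (filter (λ m → coprime? m n) (applyUpTo suc n))

φ>0 : ∀ n → 0 < n → 0 < φ n
φ>0 n@(suc _) _ = nonempty (∈-filter⁺ (λ m → coprime? m n)
                                      (∈-applyUpTo⁺ suc (s≤s z≤n))
                                      (1-coprimeTo n))
  where
  nonempty : ∀ {x} {xs : List ℕ} → x ∈ xs → 0 < length xs
  nonempty (here _)  = s≤s z≤n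
  nonempty (there _) = s≤s z≤n

AbcPair : ℕ → Pred (ℕ × ℕ) 0ℓ
AbcPair c (a , b) = 0 < a × 0 < b × a + b ≡ c × a < b × Coprime a b

abcPair? : ∀ c → Decidable (AbcPair c)
abcPair? c (a , b) =
  0 <? a ×-dec 0 <? b ×-dec a + b ≟ c ×-dec a <? b ×-dec coprime? a b

-- Every pair with a + b = c occurs among the candidates (a , c ∸ a), a ≤ c;
-- abcPairs-complete and abcPairs-unique show that the list enumerates
-- exactly the required pairs, each once.
abcPairs : ℕ → List (ℕ × ℕ)
abcPairs c = filter (abcPair? c) (map (λ a → a , c ∸ a) (upTo (suc c)))

abcPairs-complete : ∀ c a b → (a , b) ∈ abcPairs c ⇔ AbcPair c (a , b)
abcPairs-complete c a b = mk⇔ (λ p → proj₂ (∈-filter⁻ (abcPair? c) {xs = candidates} p))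
                              (λ q → ∈-filter⁺ (abcPair? c) (candidate (proj₁ (proj₂ (proj₂ q)))) q)
  where
  candidates : List (ℕ × ℕ)
  candidates = map (λ x → x , c ∸ x) (upTo (suc c))

  candidate : a + b ≡ c → (a , b) ∈ candidates
  candidate refl = subst (λ x → (a , x) ∈ candidates) (m+n∸m≡n a b)
    (∈-map⁺ (λ x → x , c ∸ x) (∈-upTo⁺ (s≤s (m≤m+n a b))))

abcPairs-unique : ∀ c → Unique (abcPairs c)
abcPairs-unique c = filter⁺ (abcPair? c) (map⁺ (cong proj₁) (upTo⁺ (suc c)))

G : ℕ → ℕ
G c = product (map (λ (a , b) → R (a * b * c)) (abcPairs c))

fromℕ : ℕ → ℚ
fromℕ n = + n ℚ./ 1

-- A real number given by its lower Dedekind cut, the set of rationals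
-- strictly below it.
LowerCut : Set₁
LowerCut = Pred ℚ 0ℓ

infix 4 _<ᶜ_
_<ᶜ_ : ℚ → LowerCut → Set
x <ᶜ r = r x

-- The real power g^(p/q), i.e. the nonnegative q-th root of g^p, for q > 0:
-- a rational x ≥ 0 lies below it iff x^q < g^p.
infix 8 _^[_/_]
_^[_/_] : ℕ → ℕ → ℕ → LowerCut
(g ^[ p / q ]) x = x ℚ.< 0ℚ ⊎ x ^ℚ q ℚ.< fromℕ (g ^ p)

{-# OPTIONS --safe #-}
-- Since a and c − a run over the same residues, G² is the product of R(a) R(c − a) R(c)
-- over all a < c coprime to c. Write each a as u q² with u ∣ R(a), so that
-- R(a) ≥ a / q(a)². The factors q(a) are small on average: at most n/m of the a ≤ n have
-- q(a) > m, whence ∏ q(a) ≤ 4ⁿ. With the crude a (c − a) ≥ c − 1 this gives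
-- G² · 256ᶜ ≥ (R(c) (c − 1))^φ(c). The loss 256ᶜ is absorbed by R(c): if c has t prime
-- divisors then c ≤ (t + 1) φ(c), and R(c) ≥ (t + 1)! dominates any exponential in t,
-- so 256ᶜ ≤ (C R(c))^φ(c) for a constant C.

module Submission where

open import Defs
open import Data.Nat.Base using (ℕ; _≤_)
open import Data.Product.Base using (∃-syntax; _×_)

-- The bound on ∏ q is proved over the full range a ≤ c, not over the a coprime to c, so the loss is
-- exponential in c, while the main term is a power with exponent φ(c). As c / φ(c) is unbounded, a
-- constant cannot hide this loss, and the factor R(c)^φ(c) has to pay for it. It can, because c /
-- φ(c) = ∏ p / (p - 1) is large only if c has many prime divisors, and then R(c) is larger by far.
-- The count of the a with q(a) > m rests on q(a)² ∣ a and on the sum of 1/d² over d > m being at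
-- most 1/m. Adding the counts at the levels m = 1, 2, 4, ... bounds ∏ q by 2 to the power n + n/2 +
-- n/4 + ..., hence 4ⁿ. All this takes place in ℕ with denominators cleared; rationals and roots
-- enter only at the end.

module NaturalBound where

  open import Algebra.Core using (Op₂)
  open import Algebra.Structures using (IsCommutativeMonoid)
  open import Data.Bool.Base using (if_then_else_)
  open import Data.List.Base using (List; []; _∷_; foldr; map; filter; length; applyUpTo; upTo)
  open import Data.List.Membership.Propositional.Properties using (∈-filter⁺; ∈-filter⁻; ∈-upTo⁺; ∈-upTo⁻)
  open import Data.List.Properties using (map-id; map-upTo)
  open import Data.List.Relation.Unary.All as All using (All; []; _∷_)
  open import Data.List.Relation.Unary.All.Properties using (all-filter; All¬⇒¬Any)
  open import Data.List.Relation.Unary.AllPairs using ([]; _∷_)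
  open import Data.List.Relation.Unary.Unique.Propositional using (Unique)
  open import Data.List.Relation.Unary.Unique.Propositional.Properties using (filter⁺; upTo⁺)
  open import Data.Nat.Base hiding (ℕ; _≤_)
  open import Data.Nat.Coprimality as Coprimality using (Coprime; coprime?; coprime-divisor; ¬0-coprimeTo-2+)
  open import Data.Nat.Divisibility
  open import Data.Nat.ListAction using (product)
  open import Data.Nat.ListAction.Properties using (∈⇒∣product)
  open import Data.Nat.Primality
  open import Data.Nat.Primality.Factorisation using (factorise; PrimeFactorisation; factorisationHasAllPrimeFactors)
  open import Data.Nat.Properties
  open import Data.Nat.Tactic.RingSolver using (solve-∀)
  open import Data.Product.Base using (_,_; proj₁; proj₂)
  open import Data.Sum.Base using (_⊎_; inj₁; inj₂; fromInj₂)
  open import Data.Unit.Base using (tt)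
  open import Function.Base using (_∘_; case_of_; id)
  open import Relation.Binary.Core using (_Preserves₂_⟶_⟶_)
  open import Relation.Binary.Definitions using (Tri; tri<; tri≈; tri>)
  open import Relation.Binary.PropositionalEquality
    using (_≡_; _≢_; refl; sym; trans; cong; cong₂; subst; module ≡-Reasoning)
  open import Relation.Nullary.Decidable using (Dec; yes; no; does; _×-dec_)
  open import Relation.Nullary.Negation using (¬_; contradiction)
  open import Relation.Unary using (Decidable)

  -- Sums and products over initial segments of ℕ, with conditional terms

  module Fold (_∙_ : Op₂ ℕ) (ε : ℕ) (isCM : IsCommutativeMonoid _≡_ _∙_ ε)
              (∙-mono : _∙_ Preserves₂ _≤_ ⟶ _≤_ ⟶ _≤_) where

    open IsCommutativeMonoid isCM using (assoc; comm; identityˡ; identityʳ)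
    open ≡-Reasoning

    fold : (ℕ → ℕ) → ℕ → ℕ
    fold f zero    = ε
    fold f (suc n) = fold f n ∙ f n

    guard : ∀ {P : Set} → Dec P → ℕ → ℕ
    guard P? x = if does P? then x else ε

    fold-mono : ∀ {f g} n → (∀ i → i < n → f i ≤ g i) → fold f n ≤ fold g n
    fold-mono zero    f≤g = ≤-refl
    fold-mono (suc n) f≤g = ∙-mono (fold-mono n λ i i<n → f≤g i (m<n⇒m<1+n i<n)) (f≤g n ≤-refl)

    fold-cong : ∀ {f g} n → (∀ i → i < n → f i ≡ g i) → fold f n ≡ fold g n
    fold-cong zero    f≡g = refl
    fold-cong (suc n) f≡g = cong₂ _∙_ (fold-cong n λ i i<n → f≡g i (m<n⇒m<1+n i<n)) (f≡g n ≤-refl)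

    fold-const : ∀ n → fold (λ _ → ε) n ≡ ε
    fold-const zero    = refl
    fold-const (suc n) = trans (identityʳ _) (fold-const n)

    interchange : ∀ a b c d → (a ∙ b) ∙ (c ∙ d) ≡ (a ∙ c) ∙ (b ∙ d)
    interchange a b c d = begin
      (a ∙ b) ∙ (c ∙ d) ≡⟨ assoc a b (c ∙ d) ⟩
      a ∙ (b ∙ (c ∙ d)) ≡⟨ cong (a ∙_) (assoc b c d) ⟨
      a ∙ ((b ∙ c) ∙ d) ≡⟨ cong (λ x → a ∙ (x ∙ d)) (comm b c) ⟩
      a ∙ ((c ∙ b) ∙ d) ≡⟨ cong (a ∙_) (assoc c b d) ⟩
      a ∙ (c ∙ (b ∙ d)) ≡⟨ assoc a c (b ∙ d) ⟨
      (a ∙ c) ∙ (b ∙ d) ∎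

    fold-∙ : ∀ f g n → fold (λ i → f i ∙ g i) n ≡ fold f n ∙ fold g n
    fold-∙ f g zero    = sym (identityˡ ε)
    fold-∙ f g (suc n) = trans (cong (_∙ (f n ∙ g n)) (fold-∙ f g n)) (interchange _ _ _ _)

    fold-front : ∀ f n → fold f (suc n) ≡ f 0 ∙ fold (f ∘ suc) n
    fold-front f zero    = comm ε (f 0)
    fold-front f (suc n) = trans (cong (_∙ f (suc n)) (fold-front f n)) (assoc _ _ _)

    -- This is the symmetry a ↦ c - a: it turns the factors at `c ∸ a` into a second copy of the
    -- same product, which is why G² appears.
    fold-reverse : ∀ f n → fold (λ i → f (n ∸ i)) (suc n) ≡ fold f (suc n)
    fold-reverse f zero    = refl
    fold-reverse f (suc n) = begin
      fold (λ i → f (suc n ∸ i)) (suc (suc n))   ≡⟨ fold-front (λ i → f (suc n ∸ i)) (suc n) ⟩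
      f (suc n) ∙ fold (λ i → f (n ∸ i)) (suc n) ≡⟨ cong (f (suc n) ∙_) (fold-reverse f n) ⟩
      f (suc n) ∙ fold f (suc n)                 ≡⟨ comm _ _ ⟩
      fold f (suc (suc n))                       ∎

    fold-+ : ∀ f m n → fold f (m + n) ≡ fold f m ∙ fold (λ i → f (m + i)) n
    fold-+ f m zero    rewrite +-identityʳ m = sym (identityʳ _)
    fold-+ f m (suc n) rewrite +-suc m n = trans (cong (_∙ f (m + n)) (fold-+ f m n)) (assoc _ _ _)

    -- Putting the unit in place of discarded entries makes `R`, `φ` and `G` folds over whole
    -- intervals, where terms can be compared index by index and reversed.
    foldr-filter : ∀ {A : Set} {P : A → Set} (P? : Decidable P) f (g : ℕ → A) n →
      foldr _∙_ ε (map f (filter P? (applyUpTo g n))) ≡ fold (λ i → guard (P? (g i)) (f (g i))) n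
    foldr-filter P? f g zero    = refl
    foldr-filter P? f g (suc n) = trans head-split (sym (fold-front _ n))
      where
      head-split : foldr _∙_ ε (map f (filter P? (applyUpTo g (suc n)))) ≡
        guard (P? (g 0)) (f (g 0)) ∙ fold (λ i → guard (P? (g (suc i))) (f (g (suc i)))) n
      head-split with P? (g 0)
      ... | yes _ = cong (f (g 0) ∙_) (foldr-filter P? f (g ∘ suc) n)
      ... | no  _ = trans (foldr-filter P? f (g ∘ suc) n) (sym (identityˡ _))

  open module Sum = Fold _+_ 0 +-0-isCommutativeMonoid +-mono-≤ using ()
    renaming ( fold to ∑; fold-mono to ∑-mono; fold-cong to ∑-cong; fold-const to ∑-0; fold-∙ to ∑-distrib-+
             ; fold-front to ∑-front; fold-+ to ∑-split; foldr-filter to sum-filter)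
  open module Product = Fold _*_ 1 *-1-isCommutativeMonoid *-mono-≤ using (guard)
    renaming ( fold to ∏; fold-mono to ∏-mono; fold-cong to ∏-cong; fold-∙ to ∏-distrib-*
             ; fold-front to ∏-front; fold-reverse to ∏-reverse; foldr-filter to product-filter)

  ⟦_⟧ : ∀ {P : Set} → Dec P → ℕ
  ⟦ P? ⟧ = if does P? then 1 else 0

  ⟦⟧-yes : ∀ {P : Set} (P? : Dec P) → P → ⟦ P? ⟧ ≡ 1
  ⟦⟧-yes (yes _)  _ = refl
  ⟦⟧-yes (no ¬p)  p = contradiction p ¬p

  ⟦⟧-no : ∀ {P : Set} (P? : Dec P) → ¬ P → ⟦ P? ⟧ ≡ 0
  ⟦⟧-no (yes p) ¬p = contradiction p ¬p
  ⟦⟧-no (no _)  _  = refl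

  ⟦⟧-mono : ∀ {P Q : Set} (P? : Dec P) (Q? : Dec Q) → (P → Q) → ⟦ P? ⟧ ≤ ⟦ Q? ⟧
  ⟦⟧-mono (no _)  Q? P⇒Q = z≤n
  ⟦⟧-mono (yes p) Q? P⇒Q = ≤-reflexive (sym (⟦⟧-yes Q? (P⇒Q p)))

  ⟦⟧-⊎ : ∀ {P Q S : Set} (P? : Dec P) (Q? : Dec Q) (S? : Dec S) → (P → Q ⊎ S) → ⟦ P? ⟧ ≤ ⟦ Q? ⟧ + ⟦ S? ⟧
  ⟦⟧-⊎ P? (yes _) S? P⇒ = ≤-trans (⟦⟧-mono P? (yes tt) λ _ → tt) (m≤m+n _ _)
  ⟦⟧-⊎ P? (no ¬q) S? P⇒ = ⟦⟧-mono P? S? λ p → fromInj₂ (λ q → contradiction q ¬q) (P⇒ p)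

  length-filter : ∀ {A : Set} {P : A → Set} (P? : Decidable P) (g : ℕ → A) n →
    length (filter P? (applyUpTo g n)) ≡ ∑ (λ i → ⟦ P? (g i) ⟧) n
  length-filter P? g n = trans (go (filter P? (applyUpTo g n))) (sum-filter P? (λ _ → 1) g n)
    where
    go : ∀ xs → length xs ≡ foldr _+_ 0 (map (λ _ → 1) xs)
    go []       = refl
    go (x ∷ xs) = cong suc (go xs)

  ∏-^ : ∀ x e n → ∏ (λ i → x ^ e i) n ≡ x ^ ∑ e n
  ∏-^ x e zero    = refl
  ∏-^ x e (suc n) = trans (cong (_* x ^ e n) (∏-^ x e n)) (sym (^-distribˡ-+-* x (∑ e n) (e n)))

  -- Counting integers with a large square divisor

  -- At a multiple `suc n ≡ k * d` the bound for `n` gives `count * d < k * d`, so the count can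
  -- grow by one without passing `k`.
  multiples-bound : ∀ d n → ∑ (λ i → ⟦ d ∣? suc i ⟧) n * d ≤ n
  multiples-bound d zero    = z≤n
  multiples-bound d (suc n) with d ∣? suc n
  ... | no  _ = begin
    (count + 0) * d ≡⟨ cong (_* d) (+-identityʳ count) ⟩
    count * d       ≤⟨ multiples-bound d n ⟩
    n               ≤⟨ n≤1+n n ⟩
    suc n           ∎
    where
    open ≤-Reasoning
    count = ∑ (λ i → ⟦ d ∣? suc i ⟧) n
  ... | yes (divides k 1+n≡kd) = begin
    (count + 1) * d ≡⟨ cong (_* d) (+-comm count 1) ⟩
    suc count * d   ≤⟨ *-monoˡ-≤ d count<k ⟩
    k * d           ≡⟨ 1+n≡kd ⟨
    suc n           ∎
    where
    open ≤-Reasoning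
    count = ∑ (λ i → ⟦ d ∣? suc i ⟧) n
    count<k : count < k
    count<k = *-cancelʳ-< d count k (subst (count * d <_) 1+n≡kd (s≤s (multiples-bound d n)))

  -- The index `i` stands for the integer `suc i`: every square divides 0, so `q` would be unbounded
  -- there.
  module SquareDivisors (n : ℕ) (q : ℕ → ℕ) (q²∣ : ∀ i → q i * q i ∣ suc i) where

    open ≤-Reasoning

    q≤n : ∀ i → i < n → q i ≤ n
    q≤n i i<n with q i | q²∣ i
    ... | zero  | _   = z≤n
    ... | suc r | r²∣ = ≤-trans (m≤m*n (suc r) (suc r)) (≤-trans (∣⇒≤ r²∣) i<n)

    -- The cap `D` truncates the tail over d > m, so that it can be built up one value d at a time.
    between : ℕ → ℕ → ℕ
    between m D = ∑ (λ i → ⟦ m <? q i ×-dec q i ≤? D ⟧) n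

    -- The indices gained have `q i ≡ suc D`, hence `suc D * suc D ∣ suc i`.
    between-step : ∀ m D → between m (suc D) ≤ between m D + ∑ (λ i → ⟦ suc D * suc D ∣? suc i ⟧) n
    between-step m D = begin
      between m (suc D) ≤⟨ ∑-mono n pointwise ⟩
      ∑ (λ i → ⟦ m <? q i ×-dec q i ≤? D ⟧ + ⟦ suc D * suc D ∣? suc i ⟧) n
        ≡⟨ ∑-distrib-+ (λ i → ⟦ m <? q i ×-dec q i ≤? D ⟧) (λ i → ⟦ suc D * suc D ∣? suc i ⟧) n ⟩
      between m D + ∑ (λ i → ⟦ suc D * suc D ∣? suc i ⟧) n ∎
      where
      pointwise : ∀ i → i < n → ⟦ m <? q i ×-dec q i ≤? suc D ⟧ ≤
        ⟦ m <? q i ×-dec q i ≤? D ⟧ + ⟦ suc D * suc D ∣? suc i ⟧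
      pointwise i _ = ⟦⟧-⊎ (m <? q i ×-dec q i ≤? suc D) (m <? q i ×-dec q i ≤? D) (suc D * suc D ∣? suc i) split
        where
        split : m < q i × q i ≤ suc D → (m < q i × q i ≤ D) ⊎ suc D * suc D ∣ suc i
        split (m<q , q≤1+D) with q i ≤? D
        ... | yes q≤D = inj₁ (m<q , q≤D)
        ... | no  q≰D = inj₂ (subst (λ x → x * x ∣ suc i) (≤-antisym q≤1+D (≰⇒> q≰D)) (q²∣ i))

    -- The discrete form of Σ_{m < d ≤ D} n/d² ≤ n/m − n/D, multiplied by mD.
    between-bound : ∀ m .{{_ : NonZero m}} k → between m (m + k) * m * (m + k) + n * m ≤ n * (m + k)
    between-bound m zero rewrite +-identityʳ m = ≤-reflexive (cong (λ x → x * m * m + n * m) none)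
      where
      none : between m m ≡ 0
      none = trans (∑-cong n λ i _ → ⟦⟧-no (m <? q i ×-dec q i ≤? m) λ (m<q , q≤m) → <⇒≱ m<q q≤m) (∑-0 n)
    between-bound m (suc k) rewrite +-suc m k = begin
      between m (suc D) * m * suc D + n * m
        ≤⟨ +-monoˡ-≤ (n * m) (*-monoˡ-≤ (suc D) (*-monoˡ-≤ m (between-step m D))) ⟩
      (between m D + ∑ (λ i → ⟦ suc D * suc D ∣? suc i ⟧) n) * m * suc D + n * m
        ≤⟨ telescope (between m D) _ m D n (between-bound m k) (multiples-bound (suc D * suc D) n) ⟩
      n * suc D ∎
      where
      D = m + k
      instance
        D≢0 : NonZero D
        D≢0 = >-nonZero (≤-trans (>-nonZero⁻¹ m) (m≤m+n m k))
      -- Weakening (D + 1)² to D (D + 1) makes the new term n (1/D - 1/(D + 1)). Multiplying by `D`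
      -- and adding `n * m` to both sides leaves a combination of the two hypotheses.
      telescope : ∀ S x m D n .{{_ : NonZero D}} → S * m * D + n * m ≤ n * D → x * (suc D * suc D) ≤ n →
        (S + x) * m * suc D + n * m ≤ n * suc D
      telescope S x m D n S≤ x≤ = *-cancelˡ-≤ D (+-cancelʳ-≤ (n * m) _ _ (begin
        D * ((S + x) * m * suc D + n * m) + n * m                ≡⟨ expand S x m D n ⟩
        suc D * (S * m * D + n * m) + m * (x * (D * suc D))
          ≤⟨ +-mono-≤ (*-monoʳ-≤ (suc D) S≤) (*-monoʳ-≤ m (≤-trans (*-monoʳ-≤ x (*-monoˡ-≤ (suc D) (n≤1+n D))) x≤)) ⟩
        suc D * (n * D) + m * n                                  ≡⟨ collect m D n ⟩
        D * (n * suc D) + n * m                                  ∎))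
        where
        expand : ∀ S x m D n → D * ((S + x) * m * suc D + n * m) + n * m ≡
          suc D * (S * m * D + n * m) + m * (x * (D * suc D))
        expand = solve-∀
        collect : ∀ m D n → suc D * (n * D) + m * n ≡ D * (n * suc D) + n * m
        collect = solve-∀

    -- The cap `m + n` is at least every `q i` and has the shape that `between-bound` requires; its
    -- surplus term `n * m` is dropped.
    above-bound : ∀ m .{{_ : NonZero m}} → ∑ (λ i → ⟦ m <? q i ⟧) n * m ≤ n
    above-bound m = *-cancelʳ-≤ _ n (m + n) (begin
      ∑ (λ i → ⟦ m <? q i ⟧) n * m * (m + n)
        ≤⟨ *-monoˡ-≤ (m + n) (*-monoˡ-≤ m (∑-mono n λ i i<n →
             ⟦⟧-mono (m <? q i) (m <? q i ×-dec q i ≤? m + n)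
               λ m<q → m<q , ≤-trans (q≤n i i<n) (m≤n+m n m))) ⟩
      between m (m + n) * m * (m + n)         ≤⟨ m≤m+n _ (n * m) ⟩
      between m (m + n) * m * (m + n) + n * m ≤⟨ between-bound m n ⟩
      n * (m + n)                             ∎)
      where
      instance
        m+n≢0 : NonZero (m + n)
        m+n≢0 = >-nonZero (≤-trans (>-nonZero⁻¹ m) (m≤m+n m n))

    -- The binary layer cake: q ⊓ 2ᴶ picks up a factor of at most 2 at each
    -- level 2ʲ < q, and above-bound makes the level counts sum to at most 2n.
    capped-bound : ∀ J → ∃[ S ] ∏ (λ i → q i ⊓ 2 ^ J) n ≤ 2 ^ S × S * 2 ^ J + 2 * n ≤ 2 * n * 2 ^ J
    -- The second inequality is S ≤ 2n (1 - 1/2ᴶ) cleared of denominators, a partial geometric sum;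
    -- level `J` adds at most n/2ᴶ.
    capped-bound zero = 0 , (begin
      ∏ (λ i → q i ⊓ 1) n ≤⟨ ∏-mono n (λ i _ → m⊓n≤n (q i) 1) ⟩
      ∏ (λ _ → 1) n       ≡⟨ Product.fold-const n ⟩
      1                   ∎) , ≤-reflexive (sym (*-identityʳ (2 * n)))
    capped-bound (suc J) with capped-bound J
    ... | S , ∏≤ , S≤ = S + count , (begin
      ∏ (λ i → q i ⊓ 2 ^ suc J) n                     ≤⟨ ∏-mono n (λ i _ → double (q i) (2 ^ J)) ⟩
      ∏ (λ i → (q i ⊓ 2 ^ J) * 2 ^ ⟦ 2 ^ J <? q i ⟧) n ≡⟨ ∏-distrib-* (λ i → q i ⊓ 2 ^ J) _ n ⟩
      ∏ (λ i → q i ⊓ 2 ^ J) n * ∏ (λ i → 2 ^ ⟦ 2 ^ J <? q i ⟧) n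
                                                      ≡⟨ cong (∏ (λ i → q i ⊓ 2 ^ J) n *_) (∏-^ 2 _ n) ⟩
      ∏ (λ i → q i ⊓ 2 ^ J) n * 2 ^ count             ≤⟨ *-monoˡ-≤ (2 ^ count) ∏≤ ⟩
      2 ^ S * 2 ^ count                               ≡⟨ ^-distribˡ-+-* 2 S count ⟨
      2 ^ (S + count)                                 ∎) , (begin
      (S + count) * (2 * 2 ^ J) + 2 * n                   ≡⟨ expand S count (2 ^ J) n ⟩
      2 * (count * 2 ^ J) + (S * 2 ^ J + (S * 2 ^ J + 2 * n))
        ≤⟨ +-mono-≤ (*-monoʳ-≤ 2 (above-bound (2 ^ J))) (+-monoʳ-≤ (S * 2 ^ J) S≤) ⟩
      2 * n + (S * 2 ^ J + 2 * n * 2 ^ J)                 ≡⟨ shuffle S (2 ^ J) n ⟩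
      (S * 2 ^ J + 2 * n) + 2 * n * 2 ^ J                 ≤⟨ +-monoˡ-≤ (2 * n * 2 ^ J) S≤ ⟩
      2 * n * 2 ^ J + 2 * n * 2 ^ J                       ≡⟨ collect n (2 ^ J) ⟩
      2 * n * (2 * 2 ^ J)                                 ∎)
      where
      instance
        2^J≢0 : NonZero (2 ^ J)
        2^J≢0 = m^n≢0 2 J
      count = ∑ (λ i → ⟦ 2 ^ J <? q i ⟧) n
      expand : ∀ S c x n → (S + c) * (2 * x) + 2 * n ≡ 2 * (c * x) + (S * x + (S * x + 2 * n))
      expand = solve-∀
      shuffle : ∀ S x n → 2 * n + (S * x + 2 * n * x) ≡ (S * x + 2 * n) + 2 * n * x
      shuffle = solve-∀
      collect : ∀ n x → 2 * n * x + 2 * n * x ≡ 2 * n * (2 * x)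
      collect = solve-∀
      double : ∀ x y → x ⊓ (2 * y) ≤ (x ⊓ y) * 2 ^ ⟦ y <? x ⟧
      double x y = case y <? x of λ where
        (yes y<x) → begin
          x ⊓ (2 * y)              ≤⟨ m⊓n≤n x (2 * y) ⟩
          2 * y                    ≡⟨ *-comm 2 y ⟩
          y * 2 ^ 1                ≡⟨ cong₂ (λ u v → u * 2 ^ v) (sym (m≥n⇒m⊓n≡n (<⇒≤ y<x))) (sym (⟦⟧-yes (y <? x) y<x)) ⟩
          (x ⊓ y) * 2 ^ ⟦ y <? x ⟧ ∎
        (no y≮x) → begin
          x ⊓ (2 * y)              ≤⟨ m⊓n≤m x (2 * y) ⟩
          x                        ≡⟨ *-identityʳ x ⟨
          x * 2 ^ 0                ≡⟨ cong₂ (λ u v → u * 2 ^ v) (sym (m≤n⇒m⊓n≡m (≮⇒≥ y≮x))) (sym (⟦⟧-no (y <? x) y≮x)) ⟩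
          (x ⊓ y) * 2 ^ ⟦ y <? x ⟧ ∎

    -- With `J = n` the cap has no effect, since 2ⁿ > n ≥ `q i`.
    ∏q≤4^n : ∏ q n ≤ 4 ^ n
    ∏q≤4^n with capped-bound n
    ... | S , ∏≤ , S≤ = begin
      ∏ q n                   ≡⟨ ∏-cong n (λ i i<n → sym (m≤n⇒m⊓n≡m (≤-trans (q≤n i i<n) (<⇒≤ (n<2^n n))))) ⟩
      ∏ (λ i → q i ⊓ 2 ^ n) n ≤⟨ ∏≤ ⟩
      2 ^ S                   ≤⟨ ^-monoʳ-≤ 2 (*-cancelʳ-≤ S (2 * n) (2 ^ n) (≤-trans (m≤m+n _ (2 * n)) S≤)) ⟩
      2 ^ (2 * n)             ≡⟨ ^-*-assoc 2 2 n ⟨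
      4 ^ n                   ∎
      where
      instance
        2^n≢0 : NonZero (2 ^ n)
        2^n≢0 = m^n≢0 2 n
      n<2^n : ∀ n → n < 2 ^ n
      n<2^n zero    = s≤s z≤n
      n<2^n (suc n) = begin-strict
        suc n           ≤⟨ n<2^n n ⟩
        2 ^ n           <⟨ m<n+m (2 ^ n) (m^n>0 2 n) ⟩
        2 ^ n + 2 ^ n   ≡⟨ cong (2 ^ n +_) (+-identityʳ (2 ^ n)) ⟨
        2 ^ suc n       ∎

  -- Radicals, coprimality and the decomposition n = u q²

  prime-∤⇒coprime : ∀ {p m} → Prime p → ¬ p ∣ m → Coprime p m
  prime-∤⇒coprime pr p∤m (d∣p , d∣m) with prime⇒irreducible pr d∣p
  ... | inj₁ d≡1  = d≡1
  ... | inj₂ refl = contradiction d∣m p∤m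

  coprime-*-∣ : ∀ {m n o} → Coprime m n → m ∣ o → n ∣ o → m * n ∣ o
  coprime-*-∣ {m} {n} cop m∣o (divides k refl) =
    *-monoˡ-∣ n (coprime-divisor cop (subst (m ∣_) (*-comm k n) m∣o))

  coprime-* : ∀ {m n o} → Coprime m o → Coprime n o → Coprime (m * n) o
  coprime-* cop₁ cop₂ (d∣mn , d∣o) =
    cop₂ (coprime-divisor (λ (e∣d , e∣m) → cop₁ (e∣m , ∣-trans e∣d d∣o)) d∣mn , d∣o)

  distinct-primes-∣ : ∀ {ps n} → Unique ps → All Prime ps → All (_∣ n) ps → product ps ∣ n
  distinct-primes-∣ []              []         []         = 1∣ _
  distinct-primes-∣ (p∉ps ∷ unique) (pr ∷ prs) (p∣n ∷ ps∣n) =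
    coprime-*-∣ (prime-∤⇒coprime pr λ p∣ → All¬⇒¬Any p∉ps (factorisationHasAllPrimeFactors pr p∣ prs))
                p∣n (distinct-primes-∣ unique prs ps∣n)

  primeDivisors : ℕ → ℕ → List ℕ
  primeDivisors k n = filter (λ p → prime? p ×-dec p ∣? n) (upTo k)

  -- `R n` is by definition `radBelow (suc n) n`; smaller cutoffs give partial radicals, which allow
  -- induction along the primes dividing `n`.
  radBelow : ℕ → ℕ → ℕ
  radBelow k n = product (primeDivisors k n)

  primeDivisors-All : ∀ k n → All (λ p → Prime p × p ∣ n) (primeDivisors k n)
  primeDivisors-All k n = all-filter (λ p → prime? p ×-dec p ∣? n) (upTo k)

  primeDivisors-prime : ∀ k n → All Prime (primeDivisors k n)
  primeDivisors-prime k n = All.map proj₁ (primeDivisors-All k n)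

  radBelow≢0 : ∀ k n → NonZero (radBelow k n)
  radBelow≢0 k n = productOfPrimes≢0 (primeDivisors-prime k n)

  radBelow-∣ : ∀ k n {m} → (∀ {p} → Prime p → p ∣ n → p ∣ m) → radBelow k n ∣ m
  radBelow-∣ k n divides-m = distinct-primes-∣
    (filter⁺ (λ p → prime? p ×-dec p ∣? n) (upTo⁺ k)) (primeDivisors-prime k n)
    (All.map (λ (pr , p∣n) → divides-m pr p∣n) (primeDivisors-All k n))

  radBelow∣n : ∀ k n → radBelow k n ∣ n
  radBelow∣n k n = radBelow-∣ k n λ _ p∣n → p∣n

  prime-∣-radBelow⇒< : ∀ {p} k n → Prime p → p ∣ radBelow k n → p < k
  prime-∣-radBelow⇒< k n pr p∣ = ∈-upTo⁻ (proj₁ (∈-filter⁻ (λ p → prime? p ×-dec p ∣? n) {xs = upTo k}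
    (factorisationHasAllPrimeFactors pr p∣ (primeDivisors-prime k n))))

  prime-∣-R : ∀ {p n} .{{_ : NonZero n}} → Prime p → p ∣ n → p ∣ R n
  prime-∣-R {p} {n} pr p∣n =
    ∈⇒∣product (∈-filter⁺ (λ p → prime? p ×-dec p ∣? n) (∈-upTo⁺ (s≤s (∣⇒≤ p∣n))) (pr , p∣n))

  R-mono-∣ : ∀ m {n} .{{_ : NonZero n}} → m ∣ n → R m ∣ R n
  R-mono-∣ m m∣n = radBelow-∣ (suc m) m λ pr p∣m → prime-∣-R pr (∣-trans p∣m m∣n)

  R-*-∣ : ∀ {m n} .{{_ : NonZero (m * n)}} → Coprime m n → R m * R n ∣ R (m * n)
  R-*-∣ {m} {n} cop = coprime-*-∣
    (λ (d∣ , d∣′) → cop (∣-trans d∣ (radBelow∣n (suc m) m) , ∣-trans d∣′ (radBelow∣n (suc n) n)))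
    (R-mono-∣ m (m∣m*n n)) (R-mono-∣ n (n∣m*n m))

  -- Squarefreeness of `u` is expressed as `u ∣ R n`, the form from which n ≤ R(n) q² is immediate.
  SquarefulDecomposition : ℕ → Set
  SquarefulDecomposition n = ∃[ u ] ∃[ q ] n ≡ u * (q * q) × u ∣ R n

  -- `u` holds the primes met an odd number of times so far: a new `p` enters `u`, or, if already
  -- there, leaves it and becomes a factor of `q`.
  decompose-product : ∀ {ps} → All Prime ps → SquarefulDecomposition (product ps)
  decompose-product []         = 1 , 1 , refl , 1∣ _
  decompose-product {p ∷ ps} prs@(pr ∷ prs′) with decompose-product prs′
  ... | u , q , Πps≡uq² , u∣R = helper (p ∣? u)
    where
    instance
      Π≢0 : NonZero (p * product ps)
      Π≢0 = productOfPrimes≢0 prs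
    u∣R′ : u ∣ R (p * product ps)
    u∣R′ = ∣-trans u∣R (R-mono-∣ (product ps) (n∣m*n p))
    helper : Dec (p ∣ u) → SquarefulDecomposition (p * product ps)
    helper (yes (divides v u≡vp)) =
      v , p * q , trans (cong (p *_) (trans Πps≡uq² (cong (_* (q * q)) u≡vp))) (absorb p v q)
        , ∣-trans (divides p (trans u≡vp (*-comm v p))) u∣R′
      where
      absorb : ∀ p v q → p * (v * p * (q * q)) ≡ v * (p * q * (p * q))
      absorb = solve-∀
    helper (no p∤u) =
      p * u , q , trans (cong (p *_) Πps≡uq²) (sym (*-assoc p u (q * q)))
        , coprime-*-∣ (prime-∤⇒coprime pr p∤u) (prime-∣-R pr (m∣m*n (product ps))) u∣R′

  decompose : ∀ n .{{_ : NonZero n}} → SquarefulDecomposition n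
  decompose n = subst SquarefulDecomposition (sym isFactorisation) (decompose-product factorsPrime)
    where open PrimeFactorisation (factorise n)

  -- The value 1 at 0 keeps that index neutral in products over 0, ..., n.
  squareRootPart : ℕ → ℕ
  squareRootPart zero    = 1
  squareRootPart (suc n) = proj₁ (proj₂ (decompose (suc n)))

  squareRootPart²∣ : ∀ n → squareRootPart (suc n) * squareRootPart (suc n) ∣ suc n
  squareRootPart²∣ n = divides (proj₁ d) (proj₁ (proj₂ (proj₂ d)))
    where d = decompose (suc n)

  squareRootPart≢0 : ∀ n → NonZero (squareRootPart n)
  squareRootPart≢0 zero    = _
  squareRootPart≢0 (suc n) = ≢-nonZero λ q≡0 →
    contradiction (0∣⇒≡0 (subst (λ q → q * q ∣ suc n) q≡0 (squareRootPart²∣ n))) λ ()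

  n≤R*squareRootPart² : ∀ n → n ≤ R n * (squareRootPart n * squareRootPart n)
  n≤R*squareRootPart² zero    = z≤n
  n≤R*squareRootPart² (suc n) with decompose (suc n)
  ... | u , q , n≡uq² , u∣R =
    ≤-trans (≤-reflexive n≡uq²) (*-monoˡ-≤ (q * q) (∣⇒≤ {{radBelow≢0 (2+ n) (suc n)}} u∣R))

  ∏squareRootPart≤4^n : ∀ n → ∏ squareRootPart (suc n) ≤ 4 ^ n
  ∏squareRootPart≤4^n n = ≤-trans
    (≤-reflexive (trans (∏-front squareRootPart n) (*-identityˡ _)))
    (SquareDivisors.∏q≤4^n n (λ i → squareRootPart (suc i)) squareRootPart²∣)

  -- Totients by sieving one prime at a time

  -- Range and modulus are separate, so that primes can enter the modulus one by one over a fixed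
  -- range. For positive `m ∣ n` the count is n φ(m) / m.
  coprimesBelow : ℕ → ℕ → ℕ
  coprimesBelow n m = ∑ (λ i → ⟦ coprime? i m ⟧) n

  ∑-periodic : ∀ f M → (∀ i → f (M + i) ≡ f i) → ∀ k → ∑ f (k * M) ≡ k * ∑ f M
  ∑-periodic f M periodic zero    = refl
  ∑-periodic f M periodic (suc k) = begin-equality
    ∑ f (M + k * M)                           ≡⟨ ∑-split f M (k * M) ⟩
    ∑ f M + ∑ (λ i → f (M + i)) (k * M)       ≡⟨ cong (∑ f M +_) (∑-cong (k * M) λ i _ → periodic i) ⟩
    ∑ f M + ∑ f (k * M)                       ≡⟨ cong (∑ f M +_) (∑-periodic f M periodic k) ⟩
    ∑ f M + k * ∑ f M                         ∎
    where open ≤-Reasoning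

  coprimesBelow-periodic : ∀ k {M m} → m ∣ M → coprimesBelow (k * M) m ≡ k * coprimesBelow M m
  coprimesBelow-periodic k {M} {m} m∣M = ∑-periodic (λ i → ⟦ coprime? i m ⟧) M shift k
    where
    shift : ∀ i → ⟦ coprime? (M + i) m ⟧ ≡ ⟦ coprime? i m ⟧
    shift i = ≤-antisym
      (⟦⟧-mono (coprime? (M + i) m) (coprime? i m)
        λ cop (d∣i , d∣m) → cop (∣m∣n⇒∣m+n (∣-trans d∣m m∣M) d∣i , d∣m))
      (⟦⟧-mono (coprime? i m) (coprime? (M + i) m)
        λ cop (d∣M+i , d∣m) → cop (∣m+n∣m⇒∣n d∣M+i (∣-trans d∣m m∣M) , d∣m))

  -- In each block of `p` indices starting at a multiple of `p`, only the first index can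
  -- contribute.
  ∑-multiples : ∀ {P : ℕ → Set} (P? : ∀ i → Dec (P i)) p .{{_ : NonZero p}} k →
    ∑ (λ i → ⟦ p ∣? i ×-dec P? i ⟧) (k * p) ≤ ∑ (λ i → ⟦ P? (i * p) ⟧) k
  ∑-multiples P? p          zero    = ≤-refl
  ∑-multiples P? p@(suc p′) (suc k) = begin
    ∑ f (p + k * p)                              ≡⟨ cong (∑ f) (+-comm p (k * p)) ⟩
    ∑ f (k * p + p)                              ≡⟨ ∑-split f (k * p) p ⟩
    ∑ f (k * p) + ∑ (λ i → f (k * p + i)) p      ≤⟨ +-mono-≤ (∑-multiples P? p k) block ⟩
    ∑ (λ i → ⟦ P? (i * p) ⟧) k + ⟦ P? (k * p) ⟧  ∎
    where
    open ≤-Reasoning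
    f : ℕ → ℕ
    f i = ⟦ p ∣? i ×-dec P? i ⟧
    vanish : ∀ i → i < p′ → f (k * p + suc i) ≡ 0
    vanish i i<p′ = ⟦⟧-no (p ∣? (k * p + suc i) ×-dec P? (k * p + suc i)) λ (p∣ , _) →
      <⇒≱ (s≤s i<p′) (∣⇒≤ (∣m+n∣m⇒∣n {p} {k * p} p∣ (n∣m*n k)))
    block : ∑ (λ i → f (k * p + i)) p ≤ ⟦ P? (k * p) ⟧
    block = begin
      ∑ (λ i → f (k * p + i)) p                            ≡⟨ ∑-front (λ i → f (k * p + i)) p′ ⟩
      f (k * p + 0) + ∑ (λ i → f (k * p + suc i)) p′
        ≡⟨ cong (f (k * p + 0) +_) (trans (∑-cong p′ vanish) (∑-0 p′)) ⟩
      f (k * p + 0) + 0                                    ≡⟨ +-identityʳ _ ⟩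
      f (k * p + 0)                                        ≡⟨ cong f (+-identityʳ (k * p)) ⟩
      f (k * p)                                            ≤⟨ ⟦⟧-mono (p ∣? (k * p) ×-dec P? (k * p)) (P? (k * p)) proj₂ ⟩
      ⟦ P? (k * p) ⟧                                       ∎

  -- This is the Euler factor 1 - 1/p, written without subtraction. The indices lost are jp with j <
  -- n/p coprime to m; as m ∣ n/p, periodicity makes them at most a share 1/p of the indices below n
  -- coprime to m.
  coprimesBelow-prime : ∀ {p m n} → Prime p → ¬ p ∣ m → p * m ∣ n →
    p * coprimesBelow n m ≤ p * coprimesBelow n (p * m) + coprimesBelow n m
  coprimesBelow-prime {p} {m} pr p∤m (divides k refl) = begin
    p * coprimesBelow n m                                ≤⟨ *-monoʳ-≤ p sieve ⟩
    p * (coprimesBelow n (p * m) + removed)              ≡⟨ *-distribˡ-+ p (coprimesBelow n (p * m)) removed ⟩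
    p * coprimesBelow n (p * m) + p * removed            ≤⟨ +-monoʳ-≤ (p * coprimesBelow n (p * m)) p*removed≤ ⟩
    p * coprimesBelow n (p * m) + coprimesBelow n m      ∎
    where
    open ≤-Reasoning
    instance
      p≢0 : NonZero p
      p≢0 = prime⇒nonZero pr
    n = k * (p * m)
    M = k * m
    coprime-m∧p∣ : ∀ i → Dec (p ∣ i × Coprime i m)
    coprime-m∧p∣ i = p ∣? i ×-dec coprime? i m
    removed = ∑ (λ i → ⟦ coprime-m∧p∣ i ⟧) n
    split : ∀ i → Coprime i m → Coprime i (p * m) ⊎ p ∣ i × Coprime i m
    split i cop with p ∣? i
    ... | yes p∣i = inj₂ (p∣i , cop)
    ... | no  p∤i = inj₁ (Coprimality.sym (coprime-* (prime-∤⇒coprime pr p∤i) (Coprimality.sym cop)))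
    sieve : coprimesBelow n m ≤ coprimesBelow n (p * m) + removed
    sieve = ≤-trans
      (∑-mono n λ i _ → ⟦⟧-⊎ (coprime? i m) (coprime? i (p * m)) (coprime-m∧p∣ i) (split i))
      (≤-reflexive (∑-distrib-+ (λ i → ⟦ coprime? i (p * m) ⟧) (λ i → ⟦ coprime-m∧p∣ i ⟧) n))
    n≡M*p : n ≡ M * p
    n≡M*p = reorder k p m
      where
      reorder : ∀ k p m → k * (p * m) ≡ k * m * p
      reorder = solve-∀
    p*removed≤ : p * removed ≤ coprimesBelow n m
    p*removed≤ = begin
      p * removed                                      ≡⟨ cong (λ x → p * ∑ (λ i → ⟦ coprime-m∧p∣ i ⟧) x) n≡M*p ⟩
      p * ∑ (λ i → ⟦ coprime-m∧p∣ i ⟧) (M * p)         ≤⟨ *-monoʳ-≤ p (∑-multiples (λ i → coprime? i m) p M) ⟩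
      p * ∑ (λ i → ⟦ coprime? (i * p) m ⟧) M
        ≤⟨ *-monoʳ-≤ p (∑-mono M λ i _ → ⟦⟧-mono (coprime? (i * p) m) (coprime? i m)
             λ cop (d∣i , d∣m) → cop (∣m⇒∣m*n p d∣i , d∣m)) ⟩
      p * coprimesBelow M m                            ≡⟨ coprimesBelow-periodic p (n∣m*n k) ⟨
      coprimesBelow (p * M) m                          ≡⟨ cong (λ x → coprimesBelow x m) (trans (*-comm p M) (sym n≡M*p)) ⟩
      coprimesBelow n m                                ∎

  radBelow-∏ : ∀ k n → radBelow k n ≡ ∏ (λ i → guard (prime? i ×-dec i ∣? n) i) k
  radBelow-∏ k n = trans (cong product (sym (map-id (primeDivisors k n))))
                         (product-filter (λ p → prime? p ×-dec p ∣? n) id id k)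

  radBelow-suc : ∀ k n → radBelow (suc k) n ≡ radBelow k n * guard (prime? k ×-dec k ∣? n) k
  radBelow-suc k n = trans (radBelow-∏ (suc k) n) (cong (_* guard (prime? k ×-dec k ∣? n) k) (sym (radBelow-∏ k n)))

  -- t counts the primes p < k dividing n. The j-th of them is at least j + 1, so their
  -- product r satisfies n / coprimesBelow n r ≤ Π (j + 1) / j = t + 1, while
  -- r ≥ (t + 1)! outgrows every exponential in t.
  TotientInvariant : (B n k r : ℕ) → Set
  TotientInvariant B n k r = ∃[ t ]
    t ≤ k ∸ 2 × n ≤ suc t * coprimesBelow n r × B ^ suc t ≤ B ^ B * r

  totient-invariant-zero : ∀ B .{{_ : NonZero B}} n → TotientInvariant B n 0 1
  totient-invariant-zero B n = 0 , z≤n , n≤ , (begin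
    B ^ 1      ≤⟨ ^-monoʳ-≤ B (>-nonZero⁻¹ B) ⟩
    B ^ B      ≡⟨ *-identityʳ (B ^ B) ⟨
    B ^ B * 1  ∎)
    where
    open ≤-Reasoning
    all-coprime : ∀ n → n ≤ coprimesBelow n 1
    all-coprime zero    = z≤n
    all-coprime (suc n) = begin
      suc n                                ≡⟨ +-comm 1 n ⟩
      n + 1
        ≤⟨ +-mono-≤ (all-coprime n) (≤-reflexive (sym (⟦⟧-yes (coprime? n 1) λ (_ , d∣1) → ∣1⇒≡1 d∣1))) ⟩
      coprimesBelow n 1 + ⟦ coprime? n 1 ⟧ ∎
    n≤ : n ≤ 1 * coprimesBelow n 1
    n≤ = ≤-trans (all-coprime n) (≤-reflexive (sym (*-identityˡ _)))

  totient-invariant-suc : ∀ B .{{_ : NonZero B}} n k → Prime k → k ∣ n →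
    TotientInvariant B n k (radBelow k n) → TotientInvariant B n (suc k) (k * radBelow k n)
  totient-invariant-suc B n k pr k∣n (t , t≤ , n≤ , B≤) = suc t , 1+t≤ , n≤′ , B≤′
    where
    open ≤-Reasoning
    r = radBelow k n
    swap : ∀ a b c → a * (b * c) ≡ b * (a * c)
    swap = solve-∀
    2≤k : 2 ≤ k
    2≤k = nonTrivial⇒n>1 k {{prime⇒nonTrivial pr}}
    2+t≤k : 2 + t ≤ k
    2+t≤k = ≤-trans (+-monoʳ-≤ 2 t≤) (≤-reflexive (m+[n∸m]≡n 2≤k))
    1+t≤ : suc t ≤ k ∸ 1
    1+t≤ = ∸-monoˡ-≤ 1 2+t≤k
    k∤r : ¬ k ∣ r
    k∤r k∣r = <-irrefl refl (prime-∣-radBelow⇒< k n pr k∣r)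
    n≤′ : n ≤ suc (suc t) * coprimesBelow n (k * r)
    n≤′ = case-pred k refl
      where
      F F′ : ℕ
      F  = coprimesBelow n r
      F′ = coprimesBelow n (k * r)
      case-pred : ∀ j → j ≡ k → n ≤ suc (suc t) * F′
      case-pred zero          refl = contradiction 2≤k λ ()
      case-pred (suc zero)    refl = contradiction 2≤k λ { (s≤s ()) }
      -- Here k = j + 1: the Euler factor gives j F ≤ (j + 1) F′, and t + 1 ≤ j gives (t + 1)(j + 1)
      -- ≤ (t + 2) j.
      case-pred (suc j@(suc _)) refl = *-cancelˡ-≤ j (begin
        j * n                            ≤⟨ *-monoʳ-≤ j n≤ ⟩
        j * (suc t * F)                  ≡⟨ swap j (suc t) F ⟩
        suc t * (j * F)                  ≤⟨ *-monoʳ-≤ (suc t) jF≤ ⟩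
        suc t * (suc j * F′)             ≡⟨ expand t j F′ ⟩
        (suc t * j + suc t) * F′         ≤⟨ *-monoˡ-≤ F′ (+-monoʳ-≤ (suc t * j) 1+t≤) ⟩
        (suc t * j + j) * F′             ≡⟨ collect t j F′ ⟩
        j * (suc (suc t) * F′)           ∎)
        where
        jF≤ : j * F ≤ suc j * F′
        jF≤ = +-cancelʳ-≤ F _ _ (begin
          j * F + F        ≡⟨ +-comm (j * F) F ⟩
          suc j * F        ≤⟨ coprimesBelow-prime pr k∤r (coprime-*-∣ (prime-∤⇒coprime pr k∤r) k∣n (radBelow∣n k n)) ⟩
          suc j * F′ + F   ∎)
        expand : ∀ t j x → suc t * (suc j * x) ≡ (suc t * j + suc t) * x
        expand = solve-∀
        collect : ∀ t j x → (suc t * j + j) * x ≡ j * (suc (suc t) * x)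
        collect = solve-∀
    B≤′ : B ^ suc (suc t) ≤ B ^ B * (k * r)
    -- A prime k ≥ B pays for the new factor `B` itself. For k ≤ B the exponent t + 2 ≤ k is still
    -- at most B, so the allowance `B ^ B` covers the whole power.
    B≤′ = case ≤-total B k of λ where
      (inj₁ B≤k) → begin
        B * B ^ suc t     ≤⟨ *-mono-≤ B≤k B≤ ⟩
        k * (B ^ B * r)   ≡⟨ swap k (B ^ B) r ⟩
        B ^ B * (k * r)   ∎
      (inj₂ k≤B) → begin
        B ^ suc (suc t)   ≤⟨ ^-monoʳ-≤ B (≤-trans 2+t≤k k≤B) ⟩
        B ^ B             ≤⟨ m≤m*n (B ^ B) (k * r) {{m*n≢0 k r {{prime⇒nonZero pr}} {{radBelow≢0 k n}}}} ⟩
        B ^ B * (k * r)   ∎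

  totient-invariant : ∀ B .{{_ : NonZero B}} n k → TotientInvariant B n k (radBelow k n)
  totient-invariant B n zero    = totient-invariant-zero B n
  totient-invariant B n (suc k) = subst (TotientInvariant B n (suc k)) (sym (radBelow-suc k n))
                                        (step (prime? k ×-dec k ∣? n) (totient-invariant B n k))
    where
    r = radBelow k n
    step : (k? : Dec (Prime k × k ∣ n)) → TotientInvariant B n k r → TotientInvariant B n (suc k) (r * guard k? k)
    step (no _) (t , t≤ , n≤,B≤) = subst (TotientInvariant B n (suc k)) (sym (*-identityʳ r))
      (t , ≤-trans t≤ (∸-monoˡ-≤ 2 (n≤1+n k)) , n≤,B≤)
    step (yes (pr , k∣n)) inv = subst (TotientInvariant B n (suc k)) (*-comm k r)
      (totient-invariant-suc B n k pr k∣n inv)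

  -- `φ` runs over 1, ..., n and the count over 0, ..., n; the extra index 0 is coprime to n only
  -- for n = 1.
  φ-coprimesBelow : ∀ n → 2 ≤ n → coprimesBelow (suc n) n ≡ φ n
  φ-coprimesBelow n@(2+ _) _ = begin-equality
    coprimesBelow (suc n) n                                ≡⟨ ∑-front (λ i → ⟦ coprime? i n ⟧) n ⟩
    ⟦ coprime? 0 n ⟧ + ∑ (λ i → ⟦ coprime? (suc i) n ⟧) n  ≡⟨ cong (_+ ∑ (λ i → ⟦ coprime? (suc i) n ⟧) n) (⟦⟧-no (coprime? 0 n) ¬0-coprimeTo-2+) ⟩
    ∑ (λ i → ⟦ coprime? (suc i) n ⟧) n                     ≡⟨ length-filter (λ m → coprime? m n) suc n ⟨
    φ n                                                    ∎
    where open ≤-Reasoning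
  φ-coprimesBelow 1 (s≤s ())

  coprime-R⇒coprime : ∀ {m n} .{{_ : NonZero n}} → Coprime m (R n) → Coprime m n
  coprime-R⇒coprime {m} {n} cop {d} (d∣m , d∣n) = only-1 factorsPrime isFactorisation
    where
    instance
      d≢0 : NonZero d
      d≢0 = ≢-nonZero λ d≡0 → ≢-nonZero⁻¹ n (0∣⇒≡0 (subst (_∣ n) d≡0 d∣n))
    open PrimeFactorisation (factorise d)
    only-1 : ∀ {ps} → All Prime ps → d ≡ product ps → d ≡ 1
    only-1 []                d≡1  = d≡1
    only-1 {p ∷ ps} (pr ∷ _) d≡pΠ = contradiction
      (cop (∣-trans p∣d d∣m , prime-∣-R pr (∣-trans p∣d d∣n))) (nonTrivial⇒≢1 {{prime⇒nonTrivial pr}})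
      where
      p∣d : p ∣ d
      p∣d = subst (p ∣_) (sym d≡pΠ) (m∣m*n (product ps))

  coprimesBelow-R≤φ : ∀ n → 2 ≤ n → coprimesBelow n (R n) ≤ φ n
  coprimesBelow-R≤φ n 2≤n = begin
    coprimesBelow n (R n) ≤⟨ ∑-mono n (λ i _ → ⟦⟧-mono (coprime? i (R n)) (coprime? i n) coprime-R⇒coprime) ⟩
    coprimesBelow n n     ≤⟨ m≤m+n (coprimesBelow n n) _ ⟩
    coprimesBelow (suc n) n ≡⟨ φ-coprimesBelow n 2≤n ⟩
    φ n                   ∎
    where
    open ≤-Reasoning
    instance
      n≢0 : NonZero n
      n≢0 = >-nonZero (≤-trans (s≤s z≤n) 2≤n)

  B^n≤[B^B*R]^φ : ∀ B .{{_ : NonZero B}} n → 2 ≤ n → B ^ n ≤ (B ^ B * R n) ^ φ n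
  B^n≤[B^B*R]^φ B n 2≤n with totient-invariant B n (suc n)
  ... | t , _ , n≤ , B≤ = begin
    B ^ n                 ≤⟨ ^-monoʳ-≤ B (≤-trans n≤ (*-monoʳ-≤ (suc t) (coprimesBelow-R≤φ n 2≤n))) ⟩
    B ^ (suc t * φ n)     ≡⟨ ^-*-assoc B (suc t) (φ n) ⟨
    (B ^ suc t) ^ φ n     ≤⟨ ^-monoˡ-≤ (φ n) B≤ ⟩
    (B ^ B * R n) ^ φ n   ∎
    where open ≤-Reasoning

  -- From the pairs a + b = c to a lower bound for G²

  R≢0 : ∀ n → NonZero (R n)
  R≢0 n = radBelow≢0 (suc n) n

  -- As `AbcPair` demands a < b, at most one of the two orders of a pair contributes R(abc); the
  -- other contributes 1.
  pairFactor : ℕ → ℕ → ℕ → ℕ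
  pairFactor c a b = guard (abcPair? c (a , b)) (R (a * b * c))

  G-∏ : ∀ c → G c ≡ ∏ (λ a → pairFactor c a (c ∸ a)) (suc c)
  G-∏ c = trans
    (cong (λ xs → product (map radical (filter (abcPair? c) xs))) (map-upTo (λ a → a , c ∸ a) (suc c)))
    (product-filter (abcPair? c) radical (λ a → a , c ∸ a) (suc c))
    where
    radical : ℕ × ℕ → ℕ
    radical (a , b) = R (a * b * c)

  squareFactor : ℕ → ℕ
  squareFactor n = squareRootPart n * squareRootPart n

  squareFactor>0 : ∀ n → 1 ≤ squareFactor n
  squareFactor>0 n = *-mono-≤ q>0 q>0
    where q>0 = >-nonZero⁻¹ (squareRootPart n) {{squareRootPart≢0 n}}

  coprime-sum : ∀ {a b} → Coprime a (a + b) → Coprime a b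
  coprime-sum cop (d∣a , d∣b) = cop (d∣a , ∣m∣n⇒∣m+n d∣a d∣b)

  coprime-product-sum : ∀ {a b} → Coprime a b → Coprime (a * b) (a + b)
  coprime-product-sum {a} {b} cop = coprime-*
    (λ (d∣a , d∣a+b) → cop (d∣a , ∣m+n∣m⇒∣n d∣a+b d∣a))
    (λ {d} (d∣b , d∣a+b) → cop (∣m+n∣m⇒∣n (subst (d ∣_) (+-comm a b) d∣a+b) d∣b , d∣b))

  -- a, b and a + b are pairwise coprime, so the product of their radicals divides R(ab(a + b)); and
  -- ab ≥ a + b - 1 because (a - 1)(b - 1) ≥ 0.
  R-abc-bound : ∀ {a b} .{{_ : NonZero a}} .{{_ : NonZero b}} → Coprime a b →
    R (a + b) * (a + b ∸ 1) ≤ R (a * b * (a + b)) * (squareFactor a * squareFactor b)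
  R-abc-bound {a} {b} cop = begin
    R c * (c ∸ 1)                                              ≤⟨ *-monoʳ-≤ (R c) (a+b-1≤ab a b) ⟩
    R c * (a * b)
      ≤⟨ *-monoʳ-≤ (R c) (*-mono-≤ (n≤R*squareRootPart² a) (n≤R*squareRootPart² b)) ⟩
    R c * ((R a * squareFactor a) * (R b * squareFactor b))    ≡⟨ rearrange (R a) (R b) (R c) _ _ ⟩
    R a * R b * R c * (squareFactor a * squareFactor b)
      ≤⟨ *-monoˡ-≤ (squareFactor a * squareFactor b) (∣⇒≤ {{R≢0 (a * b * c)}} radicals-∣) ⟩
    R (a * b * c) * (squareFactor a * squareFactor b)          ∎
    where
    open ≤-Reasoning
    c = a + b
    instance
      ab≢0 : NonZero (a * b)
      ab≢0 = m*n≢0 a b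
      abc≢0 : NonZero (a * b * c)
      abc≢0 = m*n≢0 (a * b) c {{ab≢0}} {{>-nonZero (≤-trans (>-nonZero⁻¹ a) (m≤m+n a b))}}
    radicals-∣ : R a * R b * R c ∣ R (a * b * c)
    radicals-∣ = ∣-trans (*-monoˡ-∣ (R c) (R-*-∣ cop)) (R-*-∣ (coprime-product-sum cop))
    rearrange : ∀ x y z s t → z * ((x * s) * (y * t)) ≡ x * y * z * (s * t)
    rearrange = solve-∀
    a+b-1≤ab : ∀ a b .{{_ : NonZero a}} .{{_ : NonZero b}} → a + b ∸ 1 ≤ a * b
    a+b-1≤ab (suc a) b = begin
      a + b     ≡⟨ +-comm a b ⟩
      b + a     ≤⟨ +-monoʳ-≤ b (m≤m*n a b) ⟩
      b + a * b ∎

  guard-yes : ∀ {P : Set} (P? : Dec P) x → P → guard P? x ≡ x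
  guard-yes (yes _) x p = refl
  guard-yes (no ¬p) x p = contradiction p ¬p

  pairFactor-yes : ∀ {c a b} → AbcPair c (a , b) → pairFactor c a b ≡ R (a * b * c)
  pairFactor-yes {c} {a} {b} = guard-yes (abcPair? c (a , b)) (R (a * b * c))

  pairFactor>0 : ∀ c a b → 1 ≤ pairFactor c a b
  pairFactor>0 c a b = guard>0 (abcPair? c (a , b))
    where
    guard>0 : ∀ {P : Set} (P? : Dec P) → 1 ≤ guard P? (R (a * b * c))
    guard>0 (yes _) = >-nonZero⁻¹ _ {{R≢0 (a * b * c)}}
    guard>0 (no _)  = ≤-refl

  -- If a is not coprime to a + b, the left side is 1 and the right side is a product of positive
  -- factors; this lets the square parts of all indices be multiplied. In the coprime case a + b ≥ 3
  -- excludes a = 0, b = 0 and a = b.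
  pairFactor-bound : ∀ a b → 3 ≤ a + b → (R (a + b) * (a + b ∸ 1)) ^ ⟦ coprime? a (a + b) ⟧ ≤
    (pairFactor (a + b) a b * pairFactor (a + b) b a) * (squareFactor a * squareFactor b)
  pairFactor-bound a b 3≤c = bound (coprime? a (a + b))
    where
    open ≤-Reasoning
    c = a + b
    X = R c * (c ∸ 1)
    S = squareFactor a * squareFactor b
    P Q : ℕ
    P = pairFactor c a b
    Q = pairFactor c b a
    bound : (cop? : Dec (Coprime a c)) → X ^ ⟦ cop? ⟧ ≤ (P * Q) * S
    bound (no _) = *-mono-≤ (*-mono-≤ (pairFactor>0 c a b) (pairFactor>0 c b a))
                            (*-mono-≤ (squareFactor>0 a) (squareFactor>0 b))
    bound (yes cop) = begin
      X ^ 1                 ≡⟨ ^-identityʳ X ⟩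
      X                     ≤⟨ R-abc-bound cop-ab ⟩
      R (a * b * c) * S     ≤⟨ *-monoˡ-≤ S (R≤PQ (<-cmp a b)) ⟩
      (P * Q) * S           ∎
      where
      cop-ab : Coprime a b
      cop-ab = coprime-sum cop
      instance
        a≢0 : NonZero a
        a≢0 = ≢-nonZero λ { refl → <⇒≢ (≤-trans (s≤s (s≤s z≤n)) 3≤c) (sym (cop (b ∣0 , ∣-refl))) }
        b≢0 : NonZero b
        b≢0 = ≢-nonZero λ { refl → <⇒≢ (≤-trans (s≤s (s≤s z≤n)) 3≤c)
          (sym (cop (subst (a + 0 ∣_) (+-identityʳ a) ∣-refl , ∣-refl))) }
      a≢b : a ≢ b
      a≢b refl = contradiction (subst (λ x → 3 ≤ x + x) (cop-ab (∣-refl , ∣-refl)) 3≤c) λ { (s≤s (s≤s ())) }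
      R≤PQ : Tri (a < b) (a ≡ b) (b < a) → R (a * b * c) ≤ P * Q
      R≤PQ (tri< a<b _ _) = begin
        R (a * b * c) ≡⟨ pairFactor-yes (>-nonZero⁻¹ a , >-nonZero⁻¹ b , refl , a<b , cop-ab) ⟨
        P             ≤⟨ m≤m*n P Q {{>-nonZero (pairFactor>0 c b a)}} ⟩
        P * Q         ∎
      R≤PQ (tri≈ _ a≡b _) = contradiction a≡b a≢b
      R≤PQ (tri> _ _ b<a) = begin
        R (a * b * c) ≡⟨ cong (λ x → R (x * c)) (*-comm a b) ⟩
        R (b * a * c) ≡⟨ pairFactor-yes (>-nonZero⁻¹ b , >-nonZero⁻¹ a , +-comm b a , b<a , Coprimality.sym cop-ab) ⟨
        Q             ≤⟨ m≤n*m Q P {{>-nonZero (pairFactor>0 c a b)}} ⟩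
        P * Q         ∎

  -- Each index a brings q(a)² q(c - a)², so ∏ q occurs four times, each time at most 4ᶜ: together
  -- 256ᶜ.
  G²-bound : ∀ c → 3 ≤ c → (R c * (c ∸ 1)) ^ φ c ≤ (G c * G c) * ((4 ^ c * 4 ^ c) * (4 ^ c * 4 ^ c))
  G²-bound c 3≤c = begin
    X ^ φ c                                       ≡⟨ cong (X ^_) (φ-coprimesBelow c (≤-trans (n≤1+n 2) 3≤c)) ⟨
    X ^ coprimesBelow (suc c) c                   ≡⟨ ∏-^ X (λ i → ⟦ coprime? i c ⟧) (suc c) ⟨
    ∏ (λ i → X ^ ⟦ coprime? i c ⟧) (suc c)        ≤⟨ ∏-mono (suc c) pointwise ⟩
    ∏ (λ i → (g i * g (c ∸ i)) * (s i * s (c ∸ i))) (suc c)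
      ≡⟨ ∏-distrib-* (λ i → g i * g (c ∸ i)) (λ i → s i * s (c ∸ i)) (suc c) ⟩
    ∏ (λ i → g i * g (c ∸ i)) (suc c) * ∏ (λ i → s i * s (c ∸ i)) (suc c)
      ≡⟨ cong₂ _*_ (symmetrise g) (symmetrise s) ⟩
    (∏ g (suc c) * ∏ g (suc c)) * (∏ s (suc c) * ∏ s (suc c))
      ≤⟨ *-mono-≤ (≤-reflexive (sym (cong₂ _*_ (G-∏ c) (G-∏ c)))) (*-mono-≤ ∏s≤ ∏s≤) ⟩
    (G c * G c) * ((4 ^ c * 4 ^ c) * (4 ^ c * 4 ^ c)) ∎
    where
    open ≤-Reasoning
    X = R c * (c ∸ 1)
    s g : ℕ → ℕ
    s = squareFactor
    g i = pairFactor c i (c ∸ i)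
    ∏s≤ : ∏ s (suc c) ≤ 4 ^ c * 4 ^ c
    ∏s≤ = ≤-trans (≤-reflexive (∏-distrib-* squareRootPart squareRootPart (suc c)))
                  (*-mono-≤ (∏squareRootPart≤4^n c) (∏squareRootPart≤4^n c))
    symmetrise : ∀ f → ∏ (λ i → f i * f (c ∸ i)) (suc c) ≡ ∏ f (suc c) * ∏ f (suc c)
    symmetrise f = trans (∏-distrib-* f (λ i → f (c ∸ i)) (suc c)) (cong (∏ f (suc c) *_) (∏-reverse f c))
    at-sum : ∀ a b → a + b ≡ c → X ^ ⟦ coprime? a c ⟧ ≤ (pairFactor c a b * pairFactor c b a) * (s a * s b)
    at-sum a b refl = pairFactor-bound a b 3≤c
    pointwise : ∀ i → i < suc c → X ^ ⟦ coprime? i c ⟧ ≤ (g i * g (c ∸ i)) * (s i * s (c ∸ i))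
    -- The second argument inside `g (c ∸ i)` is `c ∸ (c ∸ i)`, which has to be read as `i`.
    pointwise i (s≤s i≤c) = subst
      (λ j → X ^ ⟦ coprime? i c ⟧ ≤ (g i * pairFactor c (c ∸ i) j) * (s i * s (c ∸ i)))
      (sym (m∸[m∸n]≡n i≤c)) (at-sum i (c ∸ i) (m+[n∸m]≡n i≤c))

  ^-distribʳ-* : ∀ m n o → (m * n) ^ o ≡ m ^ o * n ^ o
  ^-distribʳ-* m n zero    = refl
  ^-distribʳ-* m n (suc o) = trans (cong (m * n *_) (^-distribʳ-* m n o)) (Product.interchange m n (m ^ o) (n ^ o))

  -- The theorem with k = 1/K, raised to the power φ(c) and cleared of denominators. In `K`, the 2
  -- pays for c < 2 (c - 1), and `B ^ B` is the allowance for the primes below `B`.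
  G²-lower-bound : ∃[ K ] NonZero K × ∀ c → 3 ≤ c → c ^ φ c < K ^ φ c * G c ^ 2
  G²-lower-bound = 2 * B ^ B , m*n≢0 2 (B ^ B) , λ c 3≤c → bound B (λ n → sym (^-*-assoc 4 4 n)) c 3≤c
    where
    open ≤-Reasoning
    B = 4 ^ 4
    instance
      B^B≢0 : NonZero (B ^ B)
      B^B≢0 = m^n≢0 B B
    -- With `B` a variable, `B ^ B` stays symbolic; the value 256 enters only through
    -- `4 ^ (4 * n) ≡ B ^ n`.
    bound : ∀ B .{{_ : NonZero B}} → (∀ n → 4 ^ (4 * n) ≡ B ^ n) →
      ∀ c → 3 ≤ c → c ^ φ c < (2 * B ^ B) ^ φ c * G c ^ 2
    bound B 4^4n≡B^n c 3≤c = begin-strict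
      c ^ e                                  <⟨ ^-monoˡ-< e c<2d ⟩
      (2 * d) ^ e                            ≡⟨ ^-distribʳ-* 2 d e ⟩
      2 ^ e * d ^ e                          ≤⟨ *-monoʳ-≤ (2 ^ e) (*-cancelˡ-≤ (R c ^ e) cancelled) ⟩
      2 ^ e * ((B ^ B) ^ e * G c ^ 2)        ≡⟨ *-assoc (2 ^ e) ((B ^ B) ^ e) (G c ^ 2) ⟨
      2 ^ e * (B ^ B) ^ e * G c ^ 2          ≡⟨ cong (_* G c ^ 2) (^-distribʳ-* 2 (B ^ B) e) ⟨
      (2 * B ^ B) ^ e * G c ^ 2              ∎
      where
      e = φ c
      d = c ∸ 1
      2≤c : 2 ≤ c
      2≤c = ≤-trans (n≤1+n 2) 3≤c
      instance
        e≢0 : NonZero e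
        e≢0 = >-nonZero (φ>0 c (≤-trans (s≤s z≤n) 3≤c))
        R^e≢0 : NonZero (R c ^ e)
        R^e≢0 = m^n≢0 (R c) e {{R≢0 c}}
      c<2d : c < 2 * d
      c<2d = begin-strict
        c           ≡⟨ m+[n∸m]≡n {1} (≤-trans (s≤s z≤n) 3≤c) ⟨
        1 + d       <⟨ +-monoˡ-< d (∸-monoˡ-≤ 1 3≤c) ⟩
        d + d       ≡⟨ cong (d +_) (+-identityʳ d) ⟨
        2 * d       ∎
      collect : ∀ x → (4 ^ x * 4 ^ x) * (4 ^ x * 4 ^ x) ≡ 4 ^ (4 * x)
      collect x = begin-equality
        (4 ^ x * 4 ^ x) * (4 ^ x * 4 ^ x) ≡⟨ cong₂ _*_ (^-distribˡ-+-* 4 x x) (^-distribˡ-+-* 4 x x) ⟨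
        4 ^ (x + x) * 4 ^ (x + x)         ≡⟨ ^-distribˡ-+-* 4 (x + x) (x + x) ⟨
        4 ^ (x + x + (x + x))             ≡⟨ cong (4 ^_) (four x) ⟩
        4 ^ (4 * x)                       ∎
        where
        four : ∀ x → x + x + (x + x) ≡ 4 * x
        four = solve-∀
      cancelled : R c ^ e * d ^ e ≤ R c ^ e * ((B ^ B) ^ e * G c ^ 2)
      cancelled = begin
        R c ^ e * d ^ e                             ≡⟨ ^-distribʳ-* (R c) d e ⟨
        (R c * d) ^ e                               ≤⟨ G²-bound c 3≤c ⟩
        (G c * G c) * ((4 ^ c * 4 ^ c) * (4 ^ c * 4 ^ c)) ≡⟨ cong (G c * G c *_) (trans (collect c) (4^4n≡B^n c)) ⟩
        (G c * G c) * B ^ c                         ≤⟨ *-monoʳ-≤ (G c * G c) (B^n≤[B^B*R]^φ B c 2≤c) ⟩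
        (G c * G c) * (B ^ B * R c) ^ e             ≡⟨ cong (G c * G c *_) (^-distribʳ-* (B ^ B) (R c) e) ⟩
        (G c * G c) * ((B ^ B) ^ e * R c ^ e)       ≡⟨ rearrange (G c) ((B ^ B) ^ e) (R c ^ e) ⟩
        R c ^ e * ((B ^ B) ^ e * G c ^ 2)           ∎
        where
        rearrange : ∀ g x y → (g * g) * (x * y) ≡ y * (x * (g * (g * 1)))
        rearrange = solve-∀

-- Transfer to rational numbers and the lower cut

open import Data.Rational.Base using (0ℚ; _<_; _*_)
open import Algebra.Bundles using (CommutativeRing)
import Data.Integer.Base as ℤ
import Data.Integer.Properties as ℤ
import Data.Nat.Base as ℕ
open import Data.Nat.Tactic.RingSolver using (solve-∀)
open import Data.Product.Base using (_,_)
open import Data.Rational.Base as ℚ using (ℚ; 1ℚ; toℚᵘ)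
open import Data.Rational.Properties as ℚ using (toℚᵘ-injective; toℚᵘ-fromℚᵘ; toℚᵘ-homo-*; toℚᵘ-cancel-<)
open import Data.Rational.Unnormalised.Base as ℚᵘ using (mkℚᵘ; *≡*; *<*)
import Data.Rational.Unnormalised.Properties as ℚᵘ
open import Data.Sum.Base using (inj₂)
open import Relation.Binary.PropositionalEquality using (_≡_; refl; sym; trans; cong; subst₂; module ≡-Reasoning)
open import Algebra.Properties.CommutativeSemiring.Exp
  (CommutativeRing.commutativeSemiring ℚ.+-*-commutativeRing)
  using (^-distrib-*) renaming (_^_ to _^ℚ_)

toℚᵘ-fromℕ : ∀ n → toℚᵘ (fromℕ n) ℚᵘ.≃ mkℚᵘ (ℤ.+ n) 0
toℚᵘ-fromℕ n = toℚᵘ-fromℚᵘ (mkℚᵘ (ℤ.+ n) 0)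

fromℕ-* : ∀ m n → fromℕ (m ℕ.* n) ≡ fromℕ m * fromℕ n
fromℕ-* m n = toℚᵘ-injective (begin
  toℚᵘ (fromℕ (m ℕ.* n))                    ≈⟨ toℚᵘ-fromℕ (m ℕ.* n) ⟩
  mkℚᵘ (ℤ.+ (m ℕ.* n)) 0                    ≈⟨ *≡* (cong (ℤ._* ℤ.+ 1) (ℤ.pos-* m n)) ⟩
  mkℚᵘ (ℤ.+ m) 0 ℚᵘ.* mkℚᵘ (ℤ.+ n) 0        ≈⟨ ℚᵘ.*-cong (toℚᵘ-fromℕ m) (toℚᵘ-fromℕ n) ⟨
  toℚᵘ (fromℕ m) ℚᵘ.* toℚᵘ (fromℕ n)        ≈⟨ toℚᵘ-homo-* (fromℕ m) (fromℕ n) ⟨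
  toℚᵘ (fromℕ m * fromℕ n)                  ∎)
  where open ℚᵘ.≃-Reasoning

fromℕ-^ : ∀ m n → fromℕ (m ℕ.^ n) ≡ fromℕ m ^ℚ n
fromℕ-^ m ℕ.zero    = refl
fromℕ-^ m (ℕ.suc n) = trans (fromℕ-* m (m ℕ.^ n)) (cong (fromℕ m *_) (fromℕ-^ m n))

fromℕ-mono-< : ∀ {m n} → m ℕ.< n → fromℕ m < fromℕ n
fromℕ-mono-< {m} {n} m<n = toℚᵘ-cancel-< (ℚᵘ.<-respˡ-≃ (ℚᵘ.≃-sym (toℚᵘ-fromℕ m))
  (ℚᵘ.<-respʳ-≃ (ℚᵘ.≃-sym (toℚᵘ-fromℕ n)) (*<* (ℤ.*-monoʳ-<-pos (ℤ.+ 1) (ℤ.+<+ m<n)))))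

unitFraction : ∀ n .{{_ : ℕ.NonZero n}} → ℚ
unitFraction n = ℤ.+ 1 ℚ./ n

unitFraction-* : ∀ n .{{_ : ℕ.NonZero n}} → unitFraction n * fromℕ n ≡ 1ℚ
unitFraction-* n@(ℕ.suc n-1) = toℚᵘ-injective (begin
  toℚᵘ (unitFraction n * fromℕ n)           ≈⟨ toℚᵘ-homo-* (unitFraction n) (fromℕ n) ⟩
  toℚᵘ (unitFraction n) ℚᵘ.* toℚᵘ (fromℕ n) ≈⟨ ℚᵘ.*-cong (toℚᵘ-fromℚᵘ (mkℚᵘ (ℤ.+ 1) n-1)) (toℚᵘ-fromℕ n) ⟩
  mkℚᵘ (ℤ.+ 1) n-1 ℚᵘ.* mkℚᵘ (ℤ.+ n) 0      ≈⟨ *≡* (cong ℤ.+_ (rearrange n)) ⟩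
  ℚᵘ.1ℚᵘ                                    ∎)
  where
  open ℚᵘ.≃-Reasoning
  rearrange : ∀ n → (n ℕ.+ 0) ℕ.* 1 ≡ n ℕ.* 1 ℕ.+ 0
  rearrange = solve-∀

-- Multiplication by Kᵉ turns (c/K)ᵉ into cᵉ, so the inequality in ℕ is the claim times the factor
-- Kᵉ, which cancels.
^-cancel-< : ∀ (K c e g : ℕ) .{{_ : ℕ.NonZero K}} → c ℕ.^ e ℕ.< K ℕ.^ e ℕ.* g →
  (unitFraction K * fromℕ c) ^ℚ e < fromℕ g
^-cancel-< K c e g c^e<K^eg = ℚ.*-cancelˡ-<-nonNeg (fromℕ (K ℕ.^ e)) {{ℚ.normalize-nonNeg (K ℕ.^ e) 1}}
  (subst₂ _<_ lhs (fromℕ-* (K ℕ.^ e) g) (fromℕ-mono-< c^e<K^eg))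
  where
  open ≡-Reasoning
  x = unitFraction K * fromℕ c
  Kx≡c : fromℕ K * x ≡ fromℕ c
  Kx≡c = begin
    fromℕ K * (unitFraction K * fromℕ c) ≡⟨ ℚ.*-assoc (fromℕ K) (unitFraction K) (fromℕ c) ⟨
    fromℕ K * unitFraction K * fromℕ c   ≡⟨ cong (_* fromℕ c) (trans (ℚ.*-comm (fromℕ K) _) (unitFraction-* K)) ⟩
    1ℚ * fromℕ c                         ≡⟨ ℚ.*-identityˡ (fromℕ c) ⟩
    fromℕ c                              ∎
  lhs : fromℕ (c ℕ.^ e) ≡ fromℕ (K ℕ.^ e) * x ^ℚ e
  lhs = begin
    fromℕ (c ℕ.^ e)                ≡⟨ fromℕ-^ c e ⟩
    fromℕ c ^ℚ e                   ≡⟨ cong (_^ℚ e) Kx≡c ⟨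
    (fromℕ K * x) ^ℚ e             ≡⟨ ^-distrib-* (fromℕ K) x e ⟩
    fromℕ K ^ℚ e * x ^ℚ e          ≡⟨ cong (_* x ^ℚ e) (fromℕ-^ K e) ⟨
    fromℕ (K ℕ.^ e) * x ^ℚ e       ∎

open NaturalBound using (G²-lower-bound)

theorem3 : ∃[ k ] (0ℚ < k × (∀ (c : ℕ) → 3 ≤ c → k * fromℕ c <ᶜ G c ^[ 2 / φ c ]))
theorem3 = scale G²-lower-bound
  where
  -- Taking the bound as an argument keeps `K` a variable here.
  scale : ∃[ K ] ℕ.NonZero K × (∀ c → 3 ≤ c → c ℕ.^ φ c ℕ.< K ℕ.^ φ c ℕ.* G c ℕ.^ 2) →
    ∃[ k ] (0ℚ < k × (∀ (c : ℕ) → 3 ≤ c → k * fromℕ c <ᶜ G c ^[ 2 / φ c ]))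
  scale (K , K≢0 , bound) = unitFraction K {{K≢0}} , ℚ.positive⁻¹ _ {{ℚ.normalize-pos 1 K {{K≢0}}}} ,
    λ c 3≤c → inj₂ (^-cancel-< K c (φ c) (G c ℕ.^ 2) {{K≢0}} (bound c 3≤c))
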